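{- Let $U\ge1$, $L>2U+4$, and $1\le q\le 2^{U-1}$. Let $\iota:\mathbb{Z}/q\mathbb{Z}\to\{ -1,1\}^U$ be an injection such that $\iota(\mathbb{Z}/q\mathbb{Z})$ and $-\iota(\mathbb{Z}/q\mathbb{Z})$ are disjoint. Let $Q_\iota$ be the property of a tuple of functions $\alpha_u:\mathbb{Z}\times\mathbb{Z}/2\mathbb{Z}\to\mathbb{Z}/L\mathbb{Z}$, $1\le u\le U$, that each $\alpha_u$ is $(0,1)$-boolean and there exists a permutation $\sigma$ of $\mathbb{Z}/q\mathbb{Z}$ such that $(\alpha_1(n,t),\dots,\alpha_U(n,t))\in\{\iota(\sigma(\pi_q(n))),-\iota(\sigma(\pi_q(n)))\}$ for all $(n,t)\in\mathbb{Z}\times\mathbb{Z}/2\mathbb{Z}$. Then $Q_\iota$ is expressible, with a witnessing system of functional equations constructible explicitly from the data.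
   Context: $\{ -1,1\}$ is viewed inside $\mathbb{Z}/L\mathbb{Z}$; $\pi_q:\mathbb{Z}\to\mathbb{Z}/q\mathbb{Z}$ is reduction mod $q$. For an element $e$ of order 2 in an Abelian group $G$, a function $\alpha:G\to\mathbb{Z}/L\mathbb{Z}$ is $e$-boolean if it takes values in $\{ -1,+1\}$ and $\alpha(x+e)=-\alpha(x)$ for all $x$. For $G$ finitely generated Abelian and $H$ finite Abelian, a $(G,H)$-property is a set $P$ of functions $\alpha:G\to H$; it is expressible if there exist $M\in\mathbb{N}$, and for $i=1,\dots,M$ numbers $J_i$, sets $E'_i\subset H$, shifts $h_{i,j}\in G$ and sets $E_{i,j}\subset H$ ($j\le J_i$), such that $\alpha\in P$ iff for all $i$ and $x\in G$ the sets $\alpha(x+h_{i,j})+E_{i,j}$ ($j=1,\dots,J_i$) are pairwise disjoint with union $E'_i$. A property of a tuple $(\alpha_u:G\to H_u)_u$ is identified with a $(G,\prod_uH_u)$-property. -}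

module Defs where

open import Data.Nat as ℕ using (ℕ; zero; suc; NonZero)
open import Data.Nat.DivMod using (_mod_)
open import Data.Integer as ℤ using (ℤ)
open import Data.Integer.DivMod using (_%ℕ_)
open import Data.Fin using (Fin; toℕ)
open import Data.Vec using (Vec; map; zipWith; lookup)
open import Data.Sign using (Sign; opposite)
open import Data.Product using (Σ; ∃; _×_; _,_)
open import Data.Sum using (_⊎_)
open import Data.Bool using (Bool; true)
open import Data.Fin.Permutation using (Permutation′; _⟨$⟩ʳ_)
open import Function.Bundles using (_⇔_)
open import Relation.Binary.PropositionalEquality using (_≡_; _≢_)
open import Relation.Nullary using (¬_)

------------------------------------------------------------------------
-- ℤ/nℤ as Fin n with modular operations

ZMod : ℕ → Set
ZMod n = Fin n

module _ {n : ℕ} .{{_ : NonZero n}} where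
  _+ₘ_ : ZMod n → ZMod n → ZMod n
  a +ₘ b = (toℕ a ℕ.+ toℕ b) mod n

  -ₘ_ : ZMod n → ZMod n
  -ₘ a = (n ℕ.∸ toℕ a) mod n

  oneₘ : ZMod n
  oneₘ = 1 mod n

  minusOneₘ : ZMod n
  minusOneₘ = -ₘ oneₘ

-- reduction mod q : ℤ → ℤ/qℤ
π : (q : ℕ) .{{_ : NonZero q}} → ℤ → ZMod q
π q n = (n %ℕ q) mod q

-- the embedding {-1,1} ⊆ ℤ/Lℤ
signToZMod : {L : ℕ} .{{_ : NonZero L}} → Sign → ZMod L
signToZMod Sign.+ = oneₘ
signToZMod Sign.- = minusOneₘ

------------------------------------------------------------------------
-- G = ℤ × ℤ/2ℤ and H = (ℤ/Lℤ)^U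

G : Set
G = ℤ × ZMod 2

_+G_ : G → G → G
(a , s) +G (b , t) = (a ℤ.+ b , s +ₘ t)

e₀₁ : G
e₀₁ = (ℤ.0ℤ , oneₘ)

H : ℕ → ℕ → Set
H L U = Vec (ZMod L) U

_+H_ : {L U : ℕ} .{{_ : NonZero L}} → H L U → H L U → H L U
_+H_ = zipWith _+ₘ_

------------------------------------------------------------------------
-- e-boolean functions

IsBoolean : {A : Set} {L : ℕ} .{{_ : NonZero L}} →
            (A → A → A) → A → (A → ZMod L) → Set
IsBoolean _+A_ e α =
  (∀ x → α x ≡ oneₘ ⊎ α x ≡ minusOneₘ) × (∀ x → α (x +A e) ≡ -ₘ (α x))

------------------------------------------------------------------------
-- Expressible properties.  Subsets of Hh are Bool-valued predicates.

-- y ∈ a + E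
_∈_+_ : {Hh : Set} → Hh → Hh → (Hh → Bool) → (Hh → Hh → Hh) → Set
_∈_+_ {Hh} y a E _+H'_ = ∃ λ (e : Hh) → E e ≡ true × y ≡ (a +H' e)

record System (Gg Hh : Set) : Set where
  field
    M   : ℕ
    J   : Fin M → ℕ
    E′  : Fin M → Hh → Bool
    h   : (i : Fin M) → Fin (J i) → Gg
    E   : (i : Fin M) → Fin (J i) → Hh → Bool

-- α satisfies the system: for all i and x, the sets α(x+h_{i,j}) + E_{i,j}
-- are pairwise disjoint with union E′_i.
Satisfies : {Gg Hh : Set} → (Gg → Gg → Gg) → (Hh → Hh → Hh) →
            System Gg Hh → (Gg → Hh) → Set
Satisfies {Gg} _+g_ _+h_ S α =
  ∀ (i : Fin M) (x : Gg) →
    (∀ (j k : Fin (J i)) → j ≢ k → ∀ y →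
        ¬ ((y ∈ α (x +g h i j) + E i j) _+h_ × (y ∈ α (x +g h i k) + E i k) _+h_))
    × (∀ y → (E′ i y ≡ true → ∃ λ j → (y ∈ α (x +g h i j) + E i j) _+h_)
           × ((∃ λ j → (y ∈ α (x +g h i j) + E i j) _+h_) → E′ i y ≡ true))
  where open System S

Expressible : {Gg Hh : Set} → (Gg → Gg → Gg) → (Hh → Hh → Hh) →
              ((Gg → Hh) → Set) → Set
Expressible {Gg} {Hh} _+g_ _+h_ P =
  Σ (System Gg Hh) λ S → ∀ (α : Gg → Hh) → P α ⇔ Satisfies _+g_ _+h_ S α

------------------------------------------------------------------------
-- The property Q_ι of a tuple (α_1,…,α_U) : G → (ℤ/Lℤ)^U

Q : (L U q : ℕ) .{{_ : NonZero L}} .{{_ : NonZero q}} →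
    (ι : Fin q → Vec Sign U) → (G → H L U) → Set
Q L U q ι α =
  (∀ (u : Fin U) → IsBoolean _+G_ e₀₁ (λ x → lookup (α x) u))
  × Σ (Permutation′ q) λ σ → ∀ (n : ℤ) (t : ZMod 2) →
      (α (n , t) ≡ map signToZMod (ι (σ ⟨$⟩ʳ π q n))
       ⊎ α (n , t) ≡ map signToZMod (map opposite (ι (σ ⟨$⟩ʳ π q n))))

-- The system has one row per coordinate u, with shifts 0 and e = (0,1) and the cylinder sets
-- {v ∣ v_u = 0}, forcing {α_u(x), α_u(x+e)} = {+1, -1}, i.e. e-booleanness; and one row with the
-- 2q shifts (k, s), 0 ≤ k < q, and E = {0}, forcing the window α(x + (k, s)) to enumerate the 2q
-- codewords ±ι(b) without repetition. If α is boolean and α(n, 0) = ±ι(c n), the window condition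
-- says exactly that c : ℤ → ℤ/q is injective on every q consecutive integers. Such a c is
-- q-periodic, since the value dropped from a window must reappear in the next one, hence
-- c = σ ∘ π_q for the permutation σ r = c r; conversely every σ ∘ π_q has injective windows.

module Submission where

open import Defs
open import Data.Nat using (ℕ; NonZero; _≤_; _<_; _+_; _*_; _∸_; _^_)
open import Data.Fin using (Fin)
open import Data.Vec using (Vec; map)
open import Data.Sign using (Sign; opposite)
open import Function.Definitions using (Injective)
open import Relation.Binary.PropositionalEquality using (_≡_; _≢_)

open import Data.Bool using (Bool; true)
open import Data.Fin as Fin using (toℕ; fromℕ<; remQuot)
open import Data.Fin.Patterns using (0F; 1F)
import Data.Fin.Properties as Finₚ
open import Data.Fin.Permutation using (Permutation′; permutation; _⟨$⟩ʳ_; _⟨$⟩ˡ_; inverseˡ)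
open import Data.Integer as ℤ using (ℤ; +_; -[1+_]; 0ℤ; ∣_∣)
import Data.Integer.Properties as ℤₚ
open import Data.Integer.DivMod using (_%ℕ_; _/ℕ_; n%ℕd<d; a≡a%ℕn+[a/ℕn]*n)
open import Data.Integer.Tactic.RingSolver using (solve-∀)
open import Data.Nat as ℕ using (zero; suc; _%_; s≤s; z≤n)
import Data.Nat.Properties as ℕₚ
open import Data.Nat.DivMod using (_mod_; m<n⇒m%n≡m; n%n≡0; [m+n]%n≡m%n; %-distribˡ-+; m%n%n≡m%n)
open import Data.Product using (∃; ∃₂; _×_; _,_; proj₁; proj₂)
import Data.Sign.Properties as Signₚ
open import Data.Sum using (_⊎_; inj₁; inj₂)
open import Data.Vec using ([]; _∷_; lookup; zipWith; replicate)
import Data.Vec.Properties as Vecₚ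
open import Function using (_∘_; id; _⇔_; mk⇔; Equivalence; _↔_; Inverse)
open import Function.Properties.Equivalence using () renaming (trans to ⇔-trans; sym to ⇔-sym)
open import Relation.Binary.Definitions using (DecidableEquality)
open import Relation.Binary.PropositionalEquality
  using (refl; sym; trans; cong; cong₂; subst; module ≡-Reasoning)
open import Relation.Nullary using (¬_; Dec; yes; no; does; contradiction)
open import Relation.Nullary.Decidable using (dec-true; _⊎-dec_)
open import Relation.Unary using (Decidable)

does⇔ : {A : Set} (a? : Dec A) → does a? ≡ true ⇔ A
does⇔ (yes a) = mk⇔ (λ _ → a) (λ _ → refl)
does⇔ (no ¬a) = mk⇔ (λ ()) (λ a → contradiction a ¬a)

-- Satisfies _+g_ _+h_ S α unfolds definitionally to
-- ∀ i x → RowHolds _+h_ (λ j → α (x +g h i j)) (E i) (E′ i).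
RowHolds : {Hh : Set} → (Hh → Hh → Hh) → {J : ℕ} →
           (Fin J → Hh) → (Fin J → Hh → Bool) → (Hh → Bool) → Set
RowHolds _+h_ {J} a E E′ =
  (∀ (j k : Fin J) → j ≢ k → ∀ y →
     ¬ ((y ∈ a j + E j) _+h_ × (y ∈ a k + E k) _+h_))
  × (∀ y → (E′ y ≡ true → ∃ λ j → (y ∈ a j + E j) _+h_)
         × ((∃ λ j → (y ∈ a j + E j) _+h_) → E′ y ≡ true))

Enumerates : {I K : Set} → (I → K) → (K → Set) → Set
Enumerates f C = Injective _≡_ _≡_ f × (∀ z → C z ⇔ ∃ λ i → z ≡ f i)

module _ {A B K : Set} (e : A ↔ B) (f : B → K) {C : K → Set} where
  open Inverse e

  enumerates-∘to⇔ : Enumerates (f ∘ to) C ⇔ Enumerates f C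
  enumerates-∘to⇔ = mk⇔
    (λ (f∘to-injective , covers) → f-injective f∘to-injective , λ z → ⇔-trans (covers z) reindex)
    (λ (f-injective , covers) → f∘to-injective f-injective , λ z → ⇔-trans (covers z) (⇔-sym reindex))
    where
    f∘to∘from : ∀ b → f (to (from b)) ≡ f b
    f∘to∘from b = cong f (strictlyInverseˡ b)

    reindex : ∀ {z} → (∃ λ a → z ≡ f (to a)) ⇔ (∃ λ b → z ≡ f b)
    reindex = mk⇔ (λ (a , eq) → to a , eq) (λ (b , eq) → from b , trans eq (sym (f∘to∘from b)))

    f-injective : Injective _≡_ _≡_ (f ∘ to) → Injective _≡_ _≡_ f
    f-injective f∘to-injective {b} {b′} eq = begin
      b              ≡⟨ strictlyInverseˡ b ⟨
      to (from b)    ≡⟨ cong to (f∘to-injective (trans (f∘to∘from b) (trans eq (sym (f∘to∘from b′))))) ⟩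
      to (from b′)   ≡⟨ strictlyInverseˡ b′ ⟩
      b′             ∎
      where open ≡-Reasoning

    f∘to-injective : Injective _≡_ _≡_ f → Injective _≡_ _≡_ (f ∘ to)
    f∘to-injective f-injective {a} {a′} eq =
      trans (sym (strictlyInverseʳ a)) (trans (cong from (f-injective eq)) (strictlyInverseʳ a′))

module _ {Hh K : Set} (_+h_ : Hh → Hh → Hh) (p : Hh → K) (p-surjective : ∀ z → ∃ λ y → p y ≡ z)
         (E : Hh → Bool) (∈+E⇔ : ∀ {y a} → (y ∈ a + E) _+h_ ⇔ p y ≡ p a)
         {C : K → Set} (C? : Decidable C) where

  rowHolds⇔ : ∀ {J} (a : Fin J → Hh) →
              RowHolds _+h_ a (λ _ → E) (λ y → does (C? (p y))) ⇔ Enumerates (p ∘ a) C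
  rowHolds⇔ a = mk⇔ split join
    where
    open Equivalence

    split : RowHolds _+h_ a (λ _ → E) (λ y → does (C? (p y))) → Enumerates (p ∘ a) C
    split (disjoint , covers) = injective , λ z → let y , py≡z = p-surjective z in
      subst (λ z → C z ⇔ ∃ λ j → z ≡ p (a j)) py≡z (mk⇔
        (λ c → let j , y∈ = covers y .proj₁ (dec-true (C? (p y)) c) in j , ∈+E⇔ .to y∈)
        (λ (j , eq) → does⇔ (C? (p y)) .to (covers y .proj₂ (j , ∈+E⇔ .from eq))))
      where
      injective : Injective _≡_ _≡_ (p ∘ a)
      injective {j} {k} eq with j Finₚ.≟ k
      ... | yes j≡k = j≡k
      ... | no j≢k = contradiction (∈+E⇔ .from refl , ∈+E⇔ .from eq) (disjoint j k j≢k (a j))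

    join : Enumerates (p ∘ a) C → RowHolds _+h_ a (λ _ → E) (λ y → does (C? (p y)))
    join (injective , covers) =
      (λ j k j≢k y (y∈j , y∈k) → j≢k (injective (trans (sym (∈+E⇔ .to y∈j)) (∈+E⇔ .to y∈k)))) ,
      λ y → (λ c → let j , eq = covers (p y) .to (does⇔ (C? (p y)) .to c) in j , ∈+E⇔ .from eq) ,
            (λ (j , y∈) → dec-true (C? (p y)) (covers (p y) .from (j , ∈+E⇔ .to y∈)))

module _ {n : ℕ} .{{_ : NonZero n}} where

  toℕ-mod : ∀ m → toℕ (m mod n) ≡ m % n
  toℕ-mod m = Finₚ.toℕ-fromℕ< _

  zeroₘ : ZMod n
  zeroₘ = 0 mod n

  toℕ-zeroₘ : toℕ zeroₘ ≡ 0
  toℕ-zeroₘ = trans (toℕ-mod 0) (m<n⇒m%n≡m (ℕ.>-nonZero⁻¹ n))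

  toℕ-+ₘ : ∀ (a b : ZMod n) → toℕ (a +ₘ b) ≡ (toℕ a + toℕ b) % n
  toℕ-+ₘ a b = toℕ-mod (toℕ a + toℕ b)

  +ₘ-identityʳ : ∀ (a : ZMod n) → a +ₘ zeroₘ ≡ a
  +ₘ-identityʳ a = Finₚ.toℕ-injective (begin
    toℕ (a +ₘ zeroₘ)         ≡⟨ toℕ-+ₘ a zeroₘ ⟩
    (toℕ a + toℕ zeroₘ) % n  ≡⟨ cong (λ z → (toℕ a + z) % n) toℕ-zeroₘ ⟩
    (toℕ a + 0) % n          ≡⟨ cong (_% n) (ℕₚ.+-identityʳ (toℕ a)) ⟩
    toℕ a % n                ≡⟨ m<n⇒m%n≡m (Finₚ.toℕ<n a) ⟩
    toℕ a                    ∎)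
    where open ≡-Reasoning

  _⊖ₘ_ : ZMod n → ZMod n → ZMod n
  a ⊖ₘ b = (toℕ a + (n ∸ toℕ b)) mod n

  +ₘ-⊖ₘ : ∀ (a b : ZMod n) → b +ₘ (a ⊖ₘ b) ≡ a
  +ₘ-⊖ₘ a b = Finₚ.toℕ-injective (begin
    toℕ (b +ₘ (a ⊖ₘ b))                       ≡⟨ toℕ-+ₘ b (a ⊖ₘ b) ⟩
    (toℕ b + toℕ (a ⊖ₘ b)) % n                ≡⟨ cong (λ z → (toℕ b + z) % n) (toℕ-mod _) ⟩
    (toℕ b + (toℕ a + (n ∸ toℕ b)) % n) % n   ≡⟨ %-absorbʳ (toℕ b) (toℕ a + (n ∸ toℕ b)) ⟩
    (toℕ b + (toℕ a + (n ∸ toℕ b))) % n       ≡⟨ cong (_% n) rearrange ⟩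
    (toℕ a + n) % n                           ≡⟨ [m+n]%n≡m%n (toℕ a) n ⟩
    toℕ a % n                                 ≡⟨ m<n⇒m%n≡m (Finₚ.toℕ<n a) ⟩
    toℕ a                                     ∎)
    where
    open ≡-Reasoning
    %-absorbʳ : ∀ x y → (x + y % n) % n ≡ (x + y) % n
    %-absorbʳ x y = begin
      (x + y % n) % n          ≡⟨ %-distribˡ-+ x (y % n) n ⟩
      (x % n + y % n % n) % n  ≡⟨ cong (λ z → (x % n + z) % n) (m%n%n≡m%n y n) ⟩
      (x % n + y % n) % n      ≡⟨ %-distribˡ-+ x y n ⟨
      (x + y) % n              ∎
    rearrange : toℕ b + (toℕ a + (n ∸ toℕ b)) ≡ toℕ a + n
    rearrange = begin
      toℕ b + (toℕ a + (n ∸ toℕ b))  ≡⟨ ℕₚ.+-comm (toℕ b) _ ⟩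
      (toℕ a + (n ∸ toℕ b)) + toℕ b  ≡⟨ ℕₚ.+-assoc (toℕ a) _ _ ⟩
      toℕ a + ((n ∸ toℕ b) + toℕ b)  ≡⟨ cong (λ z → toℕ a + z) (ℕₚ.m∸n+n≡m (ℕₚ.<⇒≤ (Finₚ.toℕ<n b))) ⟩
      toℕ a + n                      ∎

  ⊖ₘ-self : ∀ (a : ZMod n) → a ⊖ₘ a ≡ zeroₘ
  ⊖ₘ-self a = Finₚ.toℕ-injective (begin
    toℕ (a ⊖ₘ a)               ≡⟨ toℕ-mod (toℕ a + (n ∸ toℕ a)) ⟩
    (toℕ a + (n ∸ toℕ a)) % n  ≡⟨ cong (_% n) (ℕₚ.m+[n∸m]≡n (ℕₚ.<⇒≤ (Finₚ.toℕ<n a))) ⟩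
    n % n                      ≡⟨ n%n≡0 n ⟩
    0                          ≡⟨ toℕ-zeroₘ ⟨
    toℕ zeroₘ                  ∎)
    where open ≡-Reasoning

module _ {L : ℕ} .{{_ : NonZero L}} where

  ±1 : ZMod L → Set
  ±1 z = z ≡ oneₘ ⊎ z ≡ minusOneₘ

  ±1? : Decidable ±1
  ±1? z = (z Finₚ.≟ oneₘ) ⊎-dec (z Finₚ.≟ minusOneₘ)

module _ {L : ℕ} .{{_ : NonZero L}} (2<L : 2 < L) where

  private
    1<L : 1 < L
    1<L = ℕₚ.<-trans (s≤s (s≤s z≤n)) 2<L

    0<L : 0 < L
    0<L = ℕₚ.<-trans (s≤s z≤n) 1<L

    toℕ-oneₘ : toℕ (oneₘ {L}) ≡ 1
    toℕ-oneₘ = trans (toℕ-mod 1) (m<n⇒m%n≡m 1<L)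

    toℕ-minusOneₘ : toℕ (minusOneₘ {L}) ≡ L ∸ 1
    toℕ-minusOneₘ = begin
      toℕ (minusOneₘ {L})     ≡⟨ toℕ-mod (L ∸ toℕ (oneₘ {L})) ⟩
      (L ∸ toℕ (oneₘ {L})) % L ≡⟨ cong (λ z → (L ∸ z) % L) toℕ-oneₘ ⟩
      (L ∸ 1) % L             ≡⟨ m<n⇒m%n≡m (ℕₚ.∸-monoʳ-< {L} {1} {0} (s≤s z≤n) 0<L) ⟩
      L ∸ 1                   ∎
      where open ≡-Reasoning

  -ₘ-minusOneₘ : -ₘ minusOneₘ ≡ oneₘ {L}
  -ₘ-minusOneₘ = Finₚ.toℕ-injective (begin
    toℕ (-ₘ minusOneₘ {L})        ≡⟨ toℕ-mod (L ∸ toℕ (minusOneₘ {L})) ⟩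
    (L ∸ toℕ (minusOneₘ {L})) % L ≡⟨ cong (λ z → (L ∸ z) % L) toℕ-minusOneₘ ⟩
    (L ∸ (L ∸ 1)) % L             ≡⟨ cong (_% L) (ℕₚ.m∸[m∸n]≡n 0<L) ⟩
    1 % L                         ≡⟨ toℕ-mod 1 ⟨
    toℕ (oneₘ {L})                ∎)
    where open ≡-Reasoning

  oneₘ≢minusOneₘ : oneₘ {L} ≢ minusOneₘ
  oneₘ≢minusOneₘ eq = ℕₚ.<-irrefl refl (subst (2 <_) L≡2 2<L)
    where
    L≡2 : L ≡ 2
    L≡2 = begin
      L           ≡⟨ ℕₚ.m∸n+n≡m 0<L ⟨
      (L ∸ 1) + 1 ≡⟨ cong (_+ 1) (trans (sym toℕ-minusOneₘ) (trans (cong toℕ (sym eq)) toℕ-oneₘ)) ⟩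
      2           ∎
      where open ≡-Reasoning

  -ₘ-signToZMod : ∀ s → -ₘ signToZMod {L} s ≡ signToZMod (opposite s)
  -ₘ-signToZMod Sign.+ = refl
  -ₘ-signToZMod Sign.- = -ₘ-minusOneₘ

  signToZMod-injective : Injective _≡_ _≡_ (signToZMod {L})
  signToZMod-injective {Sign.+} {Sign.+} _ = refl
  signToZMod-injective {Sign.+} {Sign.-} eq = contradiction eq oneₘ≢minusOneₘ
  signToZMod-injective {Sign.-} {Sign.+} eq = contradiction (sym eq) oneₘ≢minusOneₘ
  signToZMod-injective {Sign.-} {Sign.-} _ = refl

  ±1-cases : ∀ {a z : ZMod L} → ±1 a → ±1 z → z ≡ a ⊎ z ≡ -ₘ a
  ±1-cases (inj₁ refl) (inj₁ refl) = inj₁ refl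
  ±1-cases (inj₁ refl) (inj₂ refl) = inj₂ refl
  ±1-cases (inj₂ refl) (inj₁ refl) = inj₂ (sym -ₘ-minusOneₘ)
  ±1-cases (inj₂ refl) (inj₂ refl) = inj₁ refl

  ±1⇒≢-ₘ : ∀ {a : ZMod L} → ±1 a → a ≢ -ₘ a
  ±1⇒≢-ₘ (inj₁ refl) eq = oneₘ≢minusOneₘ eq
  ±1⇒≢-ₘ (inj₂ refl) eq = oneₘ≢minusOneₘ (sym (trans eq -ₘ-minusOneₘ))

  -ₘ-±1 : ∀ {a : ZMod L} → ±1 a → ±1 (-ₘ a)
  -ₘ-±1 (inj₁ refl) = inj₂ refl
  -ₘ-±1 (inj₂ refl) = inj₁ -ₘ-minusOneₘ

  ±1-pair⇔ : ∀ (a b : ZMod L) →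
             (a ≢ b × (∀ z → ±1 z ⇔ (z ≡ a ⊎ z ≡ b))) ⇔ (±1 a × b ≡ -ₘ a)
  ±1-pair⇔ a b = mk⇔ split join
    where
    open Equivalence
    split : a ≢ b × (∀ z → ±1 z ⇔ (z ≡ a ⊎ z ≡ b)) → ±1 a × b ≡ -ₘ a
    split (a≢b , ±1⇔) with ±1-cases (±1⇔ a .from (inj₁ refl)) (±1⇔ b .from (inj₂ refl))
    ... | inj₁ b≡a = contradiction (sym b≡a) a≢b
    ... | inj₂ b≡-a = ±1⇔ a .from (inj₁ refl) , b≡-a
    join : ±1 a × b ≡ -ₘ a → a ≢ b × (∀ z → ±1 z ⇔ (z ≡ a ⊎ z ≡ b))
    join (±1a , refl) = ±1⇒≢-ₘ ±1a , λ z → mk⇔ (±1-cases ±1a)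
      λ { (inj₁ refl) → ±1a ; (inj₂ refl) → -ₘ-±1 ±1a }

WindowInjective : {A : Set} (q : ℕ) → (ℤ → A) → Set
WindowInjective q c = ∀ n → Injective _≡_ _≡_ (λ (k : Fin q) → c (n ℤ.+ + toℕ k))

module _ {q : ℕ} .{{_ : NonZero q}} where

  toℕ-π : ∀ n → toℕ (π q n) ≡ n %ℕ q
  toℕ-π n = trans (toℕ-mod (n %ℕ q)) (m<n⇒m%n≡m (n%ℕd<d n q))

  remainders-equal : ∀ {a b} (d : ℤ) → a < q → b < q → + a ℤ.- + b ≡ d ℤ.* + q → a ≡ b
  remainders-equal {a} {b} d a<q b<q eq = multiple-of-q⇒equal ∣ d ∣ ∣a-b∣≡∣d∣*q
    where
    ∣a-b∣≡∣d∣*q : ∣ + a ℤ.- + b ∣ ≡ ∣ d ∣ ℕ.* q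
    ∣a-b∣≡∣d∣*q = trans (cong ∣_∣ eq) (ℤₚ.abs-* d (+ q))
    ∣a-b∣<q : ∣ + a ℤ.- + b ∣ < q
    ∣a-b∣<q = subst (_< q) (cong ∣_∣ (sym (ℤₚ.m-n≡m⊖n a b)))
                (ℕₚ.≤-<-trans (ℤₚ.∣m⊝n∣≤m⊔n a b) (ℕₚ.⊔-lub a<q b<q))
    multiple-of-q⇒equal : ∀ c → ∣ + a ℤ.- + b ∣ ≡ c ℕ.* q → a ≡ b
    multiple-of-q⇒equal zero e = ℤₚ.+-injective (ℤₚ.i-j≡0⇒i≡j (+ a) (+ b) (ℤₚ.∣i∣≡0⇒i≡0 e))
    multiple-of-q⇒equal (suc c) e =
      contradiction (subst (q ≤_) (sym e) (ℕₚ.m≤m+n q (c ℕ.* q))) (ℕₚ.<⇒≱ ∣a-b∣<q)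

  π-windowInjective : WindowInjective q (π q)
  π-windowInjective n {k} {k′} eq =
    Finₚ.toℕ-injective (remainders-equal (d ℤ.- d′) (Finₚ.toℕ<n k) (Finₚ.toℕ<n k′) difference)
    where
    m m′ d d′ : ℤ
    m = n ℤ.+ + toℕ k
    m′ = n ℤ.+ + toℕ k′
    d = m /ℕ q
    d′ = m′ /ℕ q
    r : ℕ
    r = m %ℕ q
    r≡r′ : r ≡ m′ %ℕ q
    r≡r′ = trans (sym (toℕ-π m)) (trans (cong toℕ eq) (toℕ-π m′))
    m′≡r+d′q : m′ ≡ + r ℤ.+ d′ ℤ.* + q
    m′≡r+d′q = trans (a≡a%ℕn+[a/ℕn]*n m′ q) (cong (λ ρ → + ρ ℤ.+ d′ ℤ.* + q) (sym r≡r′))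
    difference : + toℕ k ℤ.- + toℕ k′ ≡ (d ℤ.- d′) ℤ.* + q
    difference = begin
      + toℕ k ℤ.- + toℕ k′                          ≡⟨ cancel-n n (+ toℕ k) (+ toℕ k′) ⟩
      m ℤ.- m′                                      ≡⟨ cong₂ ℤ._-_ (a≡a%ℕn+[a/ℕn]*n m q) m′≡r+d′q ⟩
      (+ r ℤ.+ d ℤ.* + q) ℤ.- (+ r ℤ.+ d′ ℤ.* + q)  ≡⟨ cancel-r (+ r) d d′ (+ q) ⟩
      (d ℤ.- d′) ℤ.* + q                            ∎
      where
      open ≡-Reasoning
      cancel-n : ∀ n x y → x ℤ.- y ≡ (n ℤ.+ x) ℤ.- (n ℤ.+ y)
      cancel-n = solve-∀
      cancel-r : ∀ r x y q → (r ℤ.+ x ℤ.* q) ℤ.- (r ℤ.+ y ℤ.* q) ≡ (x ℤ.- y) ℤ.* q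
      cancel-r = solve-∀

  module _ {A : Set} {f : ℤ → A} (periodic : ∀ n → f (n ℤ.+ + q) ≡ f n) where

    periodic-+ℕ* : ∀ m k → f (m ℤ.+ + k ℤ.* + q) ≡ f m
    periodic-+ℕ* m zero = cong f (ℤₚ.+-identityʳ m)
    periodic-+ℕ* m (suc k) = begin
      f (m ℤ.+ + suc k ℤ.* + q)      ≡⟨ cong f (step m (+ k) (+ q)) ⟩
      f ((m ℤ.+ + q) ℤ.+ + k ℤ.* + q) ≡⟨ periodic-+ℕ* (m ℤ.+ + q) k ⟩
      f (m ℤ.+ + q)                  ≡⟨ periodic m ⟩
      f m                            ∎
      where
      open ≡-Reasoning
      step : ∀ m k q → m ℤ.+ (ℤ.1ℤ ℤ.+ k) ℤ.* q ≡ (m ℤ.+ q) ℤ.+ k ℤ.* q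
      step = solve-∀

    periodic-+* : ∀ m d → f (m ℤ.+ d ℤ.* + q) ≡ f m
    periodic-+* m (+ k) = periodic-+ℕ* m k
    periodic-+* m -[1+ k ] = begin
      f (m ℤ.+ -[1+ k ] ℤ.* + q)                       ≡⟨ periodic-+ℕ* (m ℤ.+ -[1+ k ] ℤ.* + q) (suc k) ⟨
      f ((m ℤ.+ -[1+ k ] ℤ.* + q) ℤ.+ + suc k ℤ.* + q)  ≡⟨ cong f (cancel m (+ suc k) (+ q)) ⟩
      f m                                              ∎
      where
      open ≡-Reasoning
      cancel : ∀ m x q → (m ℤ.+ (ℤ.- x) ℤ.* q) ℤ.+ x ℤ.* q ≡ m
      cancel = solve-∀

    periodic⇒residue : ∀ n → f n ≡ f (+ (n %ℕ q))
    periodic⇒residue n = trans (cong f (a≡a%ℕn+[a/ℕn]*n n q)) (periodic-+* (+ (n %ℕ q)) (n /ℕ q))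

injective⇒surjective : ∀ {n} {f : Fin n → Fin n} → Injective _≡_ _≡_ f → ∀ y → ∃ λ x → f x ≡ y
injective⇒surjective {suc n} {f} f-injective y with Finₚ.any? (λ x → f x Finₚ.≟ y)
... | yes hit = hit
... | no miss = contradiction (Finₚ.injective⇒≤ punchOut-injective) ℕₚ.1+n≰n
  where
  y≢f : ∀ x → y ≢ f x
  y≢f x y≡fx = miss (x , sym y≡fx)
  punchOut-injective : Injective _≡_ _≡_ (λ x → Fin.punchOut (y≢f x))
  punchOut-injective {x} {x′} eq = f-injective (Finₚ.punchOut-injective (y≢f x) (y≢f x′) eq)

injective⇒permutation : ∀ {n} {f : Fin n → Fin n} → Injective _≡_ _≡_ f → Permutation′ n
injective⇒permutation {f = f} f-injective =
  permutation f (proj₁ ∘ surjective) (proj₂ ∘ surjective) (λ x → f-injective (proj₂ (surjective (f x))))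
  where
  surjective : ∀ y → ∃ λ x → f x ≡ y
  surjective = injective⇒surjective f-injective

⟨$⟩ʳ-injective : ∀ {n} (σ : Permutation′ n) → Injective _≡_ _≡_ (σ ⟨$⟩ʳ_)
⟨$⟩ʳ-injective σ eq = trans (sym (inverseˡ σ)) (trans (cong (σ ⟨$⟩ˡ_) eq) (inverseˡ σ))

-- c n occurs in the window at n + 1, and injectivity of the window at n leaves only position q - 1.
windowInjective⇒periodic : ∀ {q} {c : ℤ → Fin q} → WindowInjective q c → ∀ n → c (n ℤ.+ + q) ≡ c n
windowInjective⇒periodic {zero} {c} _ n with c n
... | ()
windowInjective⇒periodic {suc q′} {c} injective n
  with k , c[n+1+k]≡cn ← injective⇒surjective (injective (n ℤ.+ ℤ.1ℤ)) (c n)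
  with toℕ k ℕ.≟ q′
... | yes k≡q′ = trans (cong c (sym (trans (ℤₚ.+-assoc n ℤ.1ℤ (+ toℕ k)) (cong (λ t → n ℤ.+ + suc t) k≡q′))))
                       c[n+1+k]≡cn
... | no k≢q′ = contradiction (cong toℕ (injective n c[n+next]≡c[n+0])) next≢0
  where
  k<q′ : toℕ k < q′
  k<q′ = ℕₚ.≤∧≢⇒< (Finₚ.toℕ≤pred[n] k) k≢q′
  next : Fin (suc q′)
  next = fromℕ< (s≤s k<q′)
  c[n+next]≡c[n+0] : c (n ℤ.+ + toℕ next) ≡ c (n ℤ.+ + toℕ {suc q′} 0F)
  c[n+next]≡c[n+0] = begin
    c (n ℤ.+ + toℕ next)          ≡⟨ cong (λ t → c (n ℤ.+ + t)) (Finₚ.toℕ-fromℕ< (s≤s k<q′)) ⟩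
    c (n ℤ.+ + suc (toℕ k))       ≡⟨ cong c (ℤₚ.+-assoc n ℤ.1ℤ (+ toℕ k)) ⟨
    c ((n ℤ.+ ℤ.1ℤ) ℤ.+ + toℕ k)  ≡⟨ c[n+1+k]≡cn ⟩
    c n                           ≡⟨ cong c (ℤₚ.+-identityʳ n) ⟨
    c (n ℤ.+ + 0)                 ∎
    where open ≡-Reasoning
  next≢0 : toℕ next ≢ 0
  next≢0 eq = ℕₚ.0≢1+n (trans (sym eq) (Finₚ.toℕ-fromℕ< (s≤s k<q′)))

+₂-selfInverse : ∀ (a s : ZMod 2) → a +ₘ (a +ₘ s) ≡ s
+₂-selfInverse 0F 0F = refl
+₂-selfInverse 0F 1F = refl
+₂-selfInverse 1F 0F = refl
+₂-selfInverse 1F 1F = refl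

+₂-cancelˡ : ∀ (a : ZMod 2) {s s′} → a +ₘ s ≡ a +ₘ s′ → s ≡ s′
+₂-cancelˡ a {s} {s′} eq =
  trans (sym (+₂-selfInverse a s)) (trans (cong (a +ₘ_) eq) (+₂-selfInverse a s′))

+₂-solve : ∀ (a t s : ZMod 2) → ∃ λ s′ → a +ₘ (t +ₘ s′) ≡ s
+₂-solve a t s = t +ₘ (a +ₘ s) , trans (cong (a +ₘ_) (+₂-selfInverse t (a +ₘ s))) (+₂-selfInverse a s)

∃₂⇔⊎ : {P : ZMod 2 → Set} → (∃ λ s → P s) ⇔ (P 0F ⊎ P 1F)
∃₂⇔⊎ = mk⇔ (λ { (0F , p) → inj₁ p ; (1F , p) → inj₂ p }) (λ { (inj₁ p) → 0F , p ; (inj₂ p) → 1F , p })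

enumerates₂⇔ : {K : Set} {f : ZMod 2 → K} {C : K → Set} →
               Enumerates f C ⇔ (f 0F ≢ f 1F × (∀ z → C z ⇔ (z ≡ f 0F ⊎ z ≡ f 1F)))
enumerates₂⇔ {f = f} = mk⇔
  (λ (f-injective , covers) → (λ eq → contradiction (f-injective eq) λ ()) , λ z → ⇔-trans (covers z) ∃₂⇔⊎)
  (λ (f0≢f1 , covers) → injective f0≢f1 , λ z → ⇔-trans (covers z) (⇔-sym ∃₂⇔⊎))
  where
  injective : f 0F ≢ f 1F → Injective _≡_ _≡_ f
  injective _ {0F} {0F} _ = refl
  injective f0≢f1 {0F} {1F} eq = contradiction eq f0≢f1
  injective f0≢f1 {1F} {0F} eq = contradiction (sym eq) f0≢f1
  injective _ {1F} {1F} _ = refl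

+G-identityʳ : ∀ x → x +G (0ℤ , 0F) ≡ x
+G-identityʳ (n , t) = cong₂ _,_ (ℤₚ.+-identityʳ n) (+ₘ-identityʳ t)

map-injective : ∀ {A B : Set} {f : A → B} {n} → Injective _≡_ _≡_ f → Injective _≡_ _≡_ (map {n = n} f)
map-injective f-injective {[]} {[]} _ = refl
map-injective f-injective {x ∷ xs} {y ∷ ys} eq =
  cong₂ _∷_ (f-injective (Vecₚ.∷-injectiveˡ eq)) (map-injective f-injective (Vecₚ.∷-injectiveʳ eq))

lookup-extensionality : ∀ {A : Set} {n} {xs ys : Vec A n} → (∀ i → lookup xs i ≡ lookup ys i) → xs ≡ ys
lookup-extensionality {xs = xs} {ys} eq =
  trans (sym (Vecₚ.tabulate∘lookup xs)) (trans (Vecₚ.tabulate-cong eq) (Vecₚ.tabulate∘lookup ys))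

module Expressibility (U L q : ℕ) .{{_ : NonZero L}} .{{_ : NonZero q}} (2<L : 2 < L)
                      (ι : Fin q → Vec Sign U) (ι-injective : Injective _≡_ _≡_ ι)
                      (ι-disjoint : ∀ a b → ι a ≢ map opposite (ι b)) where

  open Equivalence

  _≟H_ : DecidableEquality (H L U)
  _≟H_ = Vecₚ.≡-dec Finₚ._≟_

  signed : ZMod 2 → Vec Sign U → Vec Sign U
  signed 0F v = v
  signed 1F v = map opposite v

  codeword : Fin q → ZMod 2 → H L U
  codeword b s = map signToZMod (signed s (ι b))

  Codeword : H L U → Set
  Codeword y = ∃₂ λ b s → y ≡ codeword b s

  codeword? : Decidable Codeword
  codeword? y = Finₚ.any? λ b → Finₚ.any? λ s → y ≟H codeword b s

  codeword-injective : ∀ {b b′ s s′} → codeword b s ≡ codeword b′ s′ → b ≡ b′ × s ≡ s′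
  codeword-injective {b} {b′} {s} {s′} eq =
    signed-injective s s′ (map-injective (signToZMod-injective 2<L) eq)
    where
    signed-injective : ∀ s s′ → signed s (ι b) ≡ signed s′ (ι b′) → b ≡ b′ × s ≡ s′
    signed-injective 0F 0F eq = ι-injective eq , refl
    signed-injective 0F 1F eq = contradiction eq (ι-disjoint b b′)
    signed-injective 1F 0F eq = contradiction (sym eq) (ι-disjoint b′ b)
    signed-injective 1F 1F eq = ι-injective (map-injective Signₚ.opposite-injective eq) , refl

  -ₘ-codeword : ∀ b s → map -ₘ_ (codeword b s) ≡ codeword b (s +ₘ 1F)
  -ₘ-codeword b s = begin
    map -ₘ_ (map signToZMod (signed s (ι b)))       ≡⟨ Vecₚ.map-∘ -ₘ_ signToZMod _ ⟨
    map (-ₘ_ ∘ signToZMod) (signed s (ι b))         ≡⟨ Vecₚ.map-cong (-ₘ-signToZMod 2<L) _ ⟩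
    map (signToZMod ∘ opposite) (signed s (ι b))    ≡⟨ Vecₚ.map-∘ signToZMod opposite _ ⟩
    map signToZMod (map opposite (signed s (ι b)))  ≡⟨ cong (map signToZMod) (opposite-signed s) ⟩
    codeword b (s +ₘ 1F)                            ∎
    where
    open ≡-Reasoning
    opposite-signed : ∀ s → map opposite (signed s (ι b)) ≡ signed (s +ₘ 1F) (ι b)
    opposite-signed 0F = refl
    opposite-signed 1F = trans (sym (Vecₚ.map-∘ opposite opposite (ι b)))
                               (trans (Vecₚ.map-cong Signₚ.opposite-involutive (ι b)) (Vecₚ.map-id (ι b)))

  Boolean : (G → H L U) → Set
  Boolean α = ∀ u → IsBoolean _+G_ e₀₁ (λ x → lookup (α x) u)

  boolean-+e₀₁ : ∀ α → Boolean α → ∀ x → α (x +G e₀₁) ≡ map -ₘ_ (α x)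
  boolean-+e₀₁ α boolean x = lookup-extensionality λ u →
    trans (proj₂ (boolean u) x) (sym (Vecₚ.lookup-map u -ₘ_ (α x)))

  offset : Fin q × ZMod 2 → G
  offset (k , s) = (+ toℕ k , s)

  offset-zero : ∀ x → x +G offset (zeroₘ , 0F) ≡ x
  offset-zero x = trans (cong (λ k → x +G (+ k , 0F)) toℕ-zeroₘ) (+G-identityʳ x)

  window : (G → H L U) → G → Fin q × ZMod 2 → H L U
  window α x o = α (x +G offset o)

  module Labelled (α : G → H L U) (boolean : Boolean α) (c : ℤ → Fin q) (s₀ : ℤ → ZMod 2)
                  (labelled : ∀ n → α (n , 0F) ≡ codeword (c n) (s₀ n)) where

    α-codeword : ∀ n t → α (n , t) ≡ codeword (c n) (s₀ n +ₘ t)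
    α-codeword n 0F = trans (labelled n) (cong (codeword (c n)) (sym (+ₘ-identityʳ (s₀ n))))
    α-codeword n 1F = begin
      α (n , 1F)                          ≡⟨ cong α (+G-identityʳ (n , 1F)) ⟨
      α ((n , 0F) +G e₀₁)                 ≡⟨ boolean-+e₀₁ α boolean (n , 0F) ⟩
      map -ₘ_ (α (n , 0F))                ≡⟨ cong (map -ₘ_) (labelled n) ⟩
      map -ₘ_ (codeword (c n) (s₀ n))     ≡⟨ -ₘ-codeword (c n) (s₀ n) ⟩
      codeword (c n) (s₀ n +ₘ 1F)         ∎
      where open ≡-Reasoning

    window-positive : ∀ n k → ∃ λ s → α ((n , 0F) +G offset (k , s)) ≡ codeword (c (n ℤ.+ + toℕ k)) 0F
    window-positive n k = let m = n ℤ.+ + toℕ k ; s , eq = +₂-solve (s₀ m) 0F 0F in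
      s , trans (α-codeword m (0F +ₘ s)) (cong (codeword (c m)) eq)

    windowsEnumerate⇒windowInjective : (∀ x → Enumerates (window α x) Codeword) → WindowInjective q c
    windowsEnumerate⇒windowInjective windows n {k} {k′} c-eq
      with s , αₖ≡ ← window-positive n k | s′ , αₖ′≡ ← window-positive n k′ =
      cong proj₁ (proj₁ (windows (n , 0F)) {k , s} {k′ , s′}
        (trans αₖ≡ (trans (cong (λ b → codeword b 0F) c-eq) (sym αₖ′≡))))

    windowInjective⇒windowsEnumerate : WindowInjective q c → ∀ x → Enumerates (window α x) Codeword
    windowInjective⇒windowsEnumerate c-injective (n , t) = injective , covers
      where
      m : Fin q → ℤ
      m k = n ℤ.+ + toℕ k

      sign : Fin q → ZMod 2 → ZMod 2
      sign k s = s₀ (m k) +ₘ (t +ₘ s)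

      value : ∀ k s → α ((n , t) +G offset (k , s)) ≡ codeword (c (m k)) (sign k s)
      value k s = α-codeword (m k) (t +ₘ s)

      injective : Injective _≡_ _≡_ (window α (n , t))
      injective {k , s} {k′ , s′} eq
        with b≡b′ , s≡s′ ← codeword-injective {c (m k)} {c (m k′)} {sign k s} {sign k′ s′}
                              (trans (sym (value k s)) (trans eq (value k′ s′)))
        with refl ← c-injective n {k} {k′} b≡b′
        = cong (k ,_) (+₂-cancelˡ t (+₂-cancelˡ (s₀ (m k)) s≡s′))

      covered : ∀ b s → ∃ λ o → codeword b s ≡ window α (n , t) o
      covered b s with k , c≡b ← injective⇒surjective (c-injective n) b
                  with s′ , sign≡s ← +₂-solve (s₀ (m k)) t s
        = (k , s′) , sym (trans (value k s′) (cong₂ codeword c≡b sign≡s))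

      covers : ∀ y → Codeword y ⇔ ∃ λ o → y ≡ window α (n , t) o
      covers y = mk⇔ (λ { (b , s , refl) → covered b s })
                     (λ { ((k , s) , refl) → c (m k) , sign k s , value k s })

  booleanOffset : ZMod 2 → G
  booleanOffset 0F = (0ℤ , 0F)
  booleanOffset 1F = e₀₁

  zeroH : H L U
  zeroH = replicate U zeroₘ

  isZero : H L U → Bool
  isZero e = does (e ≟H zeroH)

  cylinder : Fin U → H L U → Bool
  cylinder u e = does (lookup e u Finₚ.≟ zeroₘ)

  ∈isZero⇔ : ∀ {y a} → (y ∈ a + isZero) _+H_ ⇔ y ≡ a
  ∈isZero⇔ {y} {a} = mk⇔
    (λ (e , isZero-e , y≡a+e) → trans y≡a+e (trans (cong (a +H_) (does⇔ (e ≟H zeroH) .to isZero-e)) a+0≡a))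
    (λ y≡a → zeroH , dec-true (zeroH ≟H zeroH) refl , trans y≡a (sym a+0≡a))
    where
    a+0≡a : a +H zeroH ≡ a
    a+0≡a = Vecₚ.zipWith-identityʳ +ₘ-identityʳ a

  ∈cylinder⇔ : ∀ u {y a} → (y ∈ a + cylinder u) _+H_ ⇔ lookup y u ≡ lookup a u
  ∈cylinder⇔ u {y} {a} = mk⇔
    (λ (e , cylinder-e , y≡a+e) → begin
      lookup y u                  ≡⟨ cong (λ v → lookup v u) y≡a+e ⟩
      lookup (a +H e) u           ≡⟨ Vecₚ.lookup-zipWith _+ₘ_ u a e ⟩
      lookup a u +ₘ lookup e u    ≡⟨ cong (lookup a u +ₘ_) (does⇔ (lookup e u Finₚ.≟ zeroₘ) .to cylinder-e) ⟩
      lookup a u +ₘ zeroₘ         ≡⟨ +ₘ-identityʳ (lookup a u) ⟩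
      lookup a u                  ∎)
    (λ yᵤ≡aᵤ → zipWith _⊖ₘ_ y a ,
       dec-true (_ Finₚ.≟ zeroₘ) (trans (Vecₚ.lookup-zipWith _⊖ₘ_ u y a)
                                   (trans (cong (_⊖ₘ lookup a u) yᵤ≡aᵤ) (⊖ₘ-self (lookup a u)))) ,
       sym a+[y⊖a]≡y)
    where
    open ≡-Reasoning
    a+[y⊖a]≡y : a +H zipWith _⊖ₘ_ y a ≡ y
    a+[y⊖a]≡y = lookup-extensionality λ v → begin
      lookup (a +H zipWith _⊖ₘ_ y a) v           ≡⟨ Vecₚ.lookup-zipWith _+ₘ_ v a _ ⟩
      lookup a v +ₘ lookup (zipWith _⊖ₘ_ y a) v  ≡⟨ cong (lookup a v +ₘ_) (Vecₚ.lookup-zipWith _⊖ₘ_ v y a) ⟩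
      lookup a v +ₘ (lookup y v ⊖ₘ lookup a v)   ≡⟨ +ₘ-⊖ₘ (lookup y v) (lookup a v) ⟩
      lookup y v                                 ∎

  system : System G (H L U)
  system = record { M = suc U ; J = J ; E′ = E′ ; h = h ; E = E }
    where
    J : Fin (suc U) → ℕ
    J 0F = q * 2
    J (Fin.suc u) = 2
    h : ∀ i → Fin (J i) → G
    h 0F j = offset (remQuot 2 j)
    h (Fin.suc u) = booleanOffset
    E : ∀ i → Fin (J i) → H L U → Bool
    E 0F _ = isZero
    E (Fin.suc u) _ = cylinder u
    E′ : Fin (suc U) → H L U → Bool
    E′ 0F y = does (codeword? y)
    E′ (Fin.suc u) y = does (±1? (lookup y u))

  windowRow⇔ : ∀ (α : G → H L U) x →
    RowHolds _+H_ (λ j → α (x +G offset (remQuot 2 j))) (λ _ → isZero) (λ y → does (codeword? y))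
    ⇔ Enumerates (window α x) Codeword
  windowRow⇔ α x = ⇔-trans
    (rowHolds⇔ _+H_ id (_, refl) isZero ∈isZero⇔ codeword? (λ j → α (x +G offset (remQuot 2 j))))
    (enumerates-∘to⇔ Finₚ.*↔× (window α x))

  cylinderRows⇔ : ∀ (α : G → H L U) u →
    (∀ x → RowHolds _+H_ (λ j → α (x +G booleanOffset j)) (λ _ → cylinder u) (λ y → does (±1? (lookup y u))))
    ⇔ IsBoolean _+G_ e₀₁ (λ x → lookup (α x) u)
  cylinderRows⇔ α u = mk⇔
    (λ rows → (λ x → proj₁ (aligned (rows x))) , (λ x → proj₂ (aligned (rows x))))
    (λ (±1-valued , negated) x →
       rowAt⇔ x .from (subst (BooleanAt x) (sym (+G-identityʳ x)) (±1-valued x , negated x)))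
    where
    a : G → ZMod L
    a x = lookup (α x) u

    RowAt : G → Set
    RowAt x =
      RowHolds _+H_ (λ j → α (x +G booleanOffset j)) (λ _ → cylinder u) (λ y → does (±1? (lookup y u)))

    BooleanAt : G → G → Set
    BooleanAt x v = ±1 (a v) × a (x +G e₀₁) ≡ -ₘ a v

    rowAt⇔ : ∀ x → RowAt x ⇔ BooleanAt x (x +G (0ℤ , 0F))
    rowAt⇔ x = ⇔-trans (rowHolds⇔ _+H_ (λ v → lookup v u) (λ z → replicate U z , Vecₚ.lookup-replicate u z)
                                  (cylinder u) (∈cylinder⇔ u) ±1? (λ j → α (x +G booleanOffset j)))
                       (⇔-trans enumerates₂⇔ (±1-pair⇔ 2<L _ _))

    aligned : ∀ {x} → RowAt x → BooleanAt x x
    aligned {x} row = subst (BooleanAt x) (+G-identityʳ x) (rowAt⇔ x .to row)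

  satisfies⇔ : ∀ (α : G → H L U) →
    Satisfies _+G_ _+H_ system α ⇔ (Boolean α × ∀ x → Enumerates (window α x) Codeword)
  satisfies⇔ α = mk⇔
    (λ rows → (λ u → cylinderRows⇔ α u .to (rows (Fin.suc u))) , λ x → windowRow⇔ α x .to (rows 0F x))
    (λ (boolean , windows) → λ { 0F x → windowRow⇔ α x .from (windows x)
                                ; (Fin.suc u) → cylinderRows⇔ α u .from (boolean u) })

  Q⇔ : ∀ (α : G → H L U) → Q L U q ι α ⇔ (Boolean α × ∀ x → Enumerates (window α x) Codeword)
  Q⇔ α = mk⇔ fromQ toQ
    where
    fromQ : Q L U q ι α → Boolean α × ∀ x → Enumerates (window α x) Codeword
    fromQ (boolean , σ , values) = boolean , windowInjective⇒windowsEnumerate c-windowInjective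
      where
      c : ℤ → Fin q
      c n = σ ⟨$⟩ʳ π q n
      labelling : ∀ n → ∃ λ s → α (n , 0F) ≡ codeword (c n) s
      labelling n = ∃₂⇔⊎ .from (values n 0F)
      open Labelled α boolean c (proj₁ ∘ labelling) (proj₂ ∘ labelling)
      c-windowInjective : WindowInjective q c
      c-windowInjective n eq = π-windowInjective n (⟨$⟩ʳ-injective σ eq)

    toQ : Boolean α × (∀ x → Enumerates (window α x) Codeword) → Q L U q ι α
    toQ (boolean , windows) = boolean , σ , values
      where
      labelling : ∀ n → Codeword (α (n , 0F))
      labelling n = subst (Codeword ∘ α) (offset-zero (n , 0F))
                          (windows (n , 0F) .proj₂ _ .from ((zeroₘ , 0F) , refl))
      c : ℤ → Fin q
      c n = proj₁ (labelling n)
      s₀ : ℤ → ZMod 2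
      s₀ n = proj₁ (proj₂ (labelling n))
      open Labelled α boolean c s₀ (proj₂ ∘ proj₂ ∘ labelling)
      c-windowInjective : WindowInjective q c
      c-windowInjective = windowsEnumerate⇒windowInjective windows
      σ : Permutation′ q
      σ = injective⇒permutation (c-windowInjective 0ℤ)
      c≡σπ : ∀ n → c n ≡ σ ⟨$⟩ʳ π q n
      c≡σπ n = trans (periodic⇒residue (windowInjective⇒periodic c-windowInjective) n)
                     (cong (c ∘ +_) (sym (toℕ-π n)))
      values : ∀ n t → α (n , t) ≡ codeword (σ ⟨$⟩ʳ π q n) 0F ⊎ α (n , t) ≡ codeword (σ ⟨$⟩ʳ π q n) 1F
      values n t = ∃₂⇔⊎ {P = λ s → α (n , t) ≡ codeword (σ ⟨$⟩ʳ π q n) s} .to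
        (s₀ n +ₘ t , subst (λ b → α (n , t) ≡ codeword b (s₀ n +ₘ t)) (c≡σπ n) (α-codeword n t))

  expressible : Expressible _+G_ _+H_ (Q L U q ι)
  expressible = system , λ α → ⇔-trans (Q⇔ α) (⇔-sym (satisfies⇔ α))

lemma6p13 : (U L q : ℕ) .{{_ : NonZero L}} .{{_ : NonZero q}} →
    1 ≤ U → 2 * U + 4 < L → 1 ≤ q → q ≤ 2 ^ (U ∸ 1) →
    (ι : Fin q → Vec Sign U) → Injective _≡_ _≡_ ι →
    (∀ a b → ι a ≢ map opposite (ι b)) →
    Expressible _+G_ _+H_ (Q L U q ι)
lemma6p13 U L q _ 2U+4<L _ _ ι ι-injective ι-disjoint =
  Expressibility.expressible U L q 2<L ι ι-injective ι-disjoint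
  where
  2<L : 2 < L
  2<L = ℕₚ.<-≤-trans (s≤s (s≤s (s≤s z≤n))) (ℕₚ.≤-trans (ℕₚ.m≤n+m 4 (2 * U)) (ℕₚ.<⇒≤ 2U+4<L))
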